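{- For every positive integer $n$, $\sigma_{od}\mathrm{meex}(n)=2\,p_{ed}(n)$.
   Context: For $n\ge 0$, $\mathcal{P}_{od}(n)$ is the set of all partitions of $n$ in which no odd part is repeated (even parts may appear with any multiplicity), and $p_{ed}(n)$ is the number of partitions of $n$ in which no even part is repeated (odd parts may appear with any multiplicity). For $\lambda\in\mathcal{P}_{od}(n)$, $\mathrm{meex}(\lambda)$ is the smallest positive even integer that is not a part of $\lambda$. Define $\sigma_{od}\mathrm{meex}(n):=\sum_{\lambda\in\mathcal{P}_{od}(n)}\mathrm{meex}(\lambda)$. -}

module Defs where

open import Data.Nat using (ℕ; zero; suc; _+_; _*_; _≤_; _<_; _≥_; z≤n; s≤s; _≟_; _≤?_; _<?_; _≥?_)
open import Data.Nat.Properties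
open import Data.Nat.Divisibility using (_∣_; _∣?_; divides; n∣m*n)
open import Data.Nat.ListAction using (sum)
open import Data.List using (List; []; _∷_; length; map; filter; upTo; cartesianProductWith)
open import Data.List.Properties using (∷-injective)
open import Data.List.Membership.Propositional using (_∈_; _∉_)
open import Data.List.Membership.Propositional.Properties using (∈-filter⁺; ∈-filter⁻; ∈-upTo⁺; ∈-cartesianProductWith⁺; ∈-cartesianProductWith⁻)
open import Data.List.Membership.DecPropositional _≟_ using (_∈?_)
open import Data.List.Relation.Unary.All as All using (All; []; _∷_; all?)
open import Data.List.Relation.Unary.AllPairs using ([]; _∷_)
open import Data.List.Relation.Unary.Any using (here; there)
open import Data.List.Relation.Unary.Linked using (Linked; linked?)
open import Data.List.Relation.Unary.Unique.Propositional using (Unique)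
import Data.List.Relation.Unary.Unique.Propositional.Properties as Unique
open import Data.Product using (_×_; _,_; proj₂)
open import Data.Sum using (inj₁; inj₂)
open import Function using (_⇔_; mk⇔)
open import Relation.Nullary using (¬_; Dec; yes; no; contradiction)
open import Relation.Nullary.Decidable using (_×-dec_; _→-dec_; ¬?)
open import Relation.Binary.PropositionalEquality using (_≡_; refl; sym; subst)

IsPartition : ℕ → List ℕ → Set
IsPartition n π = Linked _≥_ π × All (0 <_) π × sum π ≡ n

isPartition? : ∀ n π → Dec (IsPartition n π)
isPartition? n π = linked? _≥?_ π ×-dec all? (0 <?_) π ×-dec (sum π ≟ n)

multiplicity : ℕ → List ℕ → ℕ
multiplicity k π = length (filter (k ≟_) π)

Even Odd : ℕ → Set
Even k = 2 ∣ k
Odd k = ¬ Even k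

NoOddPartRepeated NoEvenPartRepeated : List ℕ → Set
NoOddPartRepeated π = All (λ k → Odd k → multiplicity k π ≤ 1) π
NoEvenPartRepeated π = All (λ k → Even k → multiplicity k π ≤ 1) π

noOddPartRepeated? : ∀ π → Dec (NoOddPartRepeated π)
noOddPartRepeated? π = all? (λ k → ¬? (2 ∣? k) →-dec (multiplicity k π ≤? 1)) π

noEvenPartRepeated? : ∀ π → Dec (NoEvenPartRepeated π)
noEvenPartRepeated? π = all? (λ k → (2 ∣? k) →-dec (multiplicity k π ≤? 1)) π

-- All lists of length at most l with entries at most m, each listed once.
boundedLists : ℕ → ℕ → List (List ℕ)
boundedLists m zero    = [] ∷ []
boundedLists m (suc l) = [] ∷ cartesianProductWith _∷_ (upTo (suc m)) (boundedLists m l)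

-- A partition of n has at most n parts, each at most n, so nothing is missed
-- (see ∈-partitions and partitions-unique).
partitions : ℕ → List (List ℕ)
partitions n = filter (isPartition? n) (boundedLists n n)

Pod Ped : ℕ → List (List ℕ)
Pod n = filter noOddPartRepeated? (partitions n)
Ped n = filter noEvenPartRepeated? (partitions n)

p-ed : ℕ → ℕ
p-ed n = length (Ped n)

-- The first of 2i, 2(i+1), …, 2(i+f) that is not in π, where 2(i+f) is
-- returned untested.
meexFrom : ℕ → ℕ → List ℕ → ℕ
meexFrom zero    i π = i * 2
meexFrom (suc f) i π with i * 2 ∈? π
... | yes _ = meexFrom f (suc i) π
... | no  _ = i * 2

-- 2(1 + sum π) exceeds every part of π, so sum π search steps suffice
-- (see meex-isMeex).
meex : List ℕ → ℕ
meex π = meexFrom (sum π) 1 π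

σ-od-meex : ℕ → ℕ
σ-od-meex n = sum (map meex (Pod n))

record IsMeex (π : List ℕ) (m : ℕ) : Set where
  field
    positive : 0 < m
    even     : Even m
    missing  : m ∉ π
    least    : ∀ j → 0 < j → Even j → j < m → j ∈ π

∈⇒≤sum : ∀ {k π} → k ∈ π → k ≤ sum π
∈⇒≤sum {π = x ∷ π} (here refl) = m≤m+n x (sum π)
∈⇒≤sum {π = x ∷ π} (there k∈π) = ≤-trans (∈⇒≤sum k∈π) (m≤n+m (sum π) x)

private
  isMeex : ∀ i π → 0 < i → i * 2 ∉ π → (∀ q → 0 < q → q < i → q * 2 ∈ π) → IsMeex π (i * 2)
  isMeex i π 0<i i∉ below = record
    { positive = *-monoˡ-< 2 0<i
    ; even     = n∣m*n i
    ; missing  = i∉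
    ; least    = λ { j 0<j (divides q refl) j<m → below q (*-cancelʳ-< 2 0 q 0<j) (*-cancelʳ-< 2 q i j<m) }
    }

  meexFrom-isMeex : ∀ f i π → 0 < i → sum π < (f + i) * 2 →
                    (∀ q → 0 < q → q < i → q * 2 ∈ π) → IsMeex π (meexFrom f i π)
  meexFrom-isMeex zero i π 0<i sum< below =
    isMeex i π 0<i (λ i∈ → <⇒≱ sum< (∈⇒≤sum i∈)) below
  meexFrom-isMeex (suc f) i π 0<i sum< below with i * 2 ∈? π
  ... | no i∉  = isMeex i π 0<i i∉ below
  ... | yes i∈ = meexFrom-isMeex f (suc i) π (s≤s z≤n)
                   (subst (λ x → sum π < x * 2) (sym (+-suc f i)) sum<) below′
    where
    below′ : ∀ q → 0 < q → q < suc i → q * 2 ∈ π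
    below′ q 0<q (s≤s q≤i) with m≤n⇒m<n∨m≡n q≤i
    ... | inj₁ q<i  = below q 0<q q<i
    ... | inj₂ refl = i∈

meex-isMeex : ∀ π → IsMeex π (meex π)
meex-isMeex π = meexFrom-isMeex (sum π) 1 π (s≤s z≤n) bound
                  (λ q 0<q q<1 → contradiction q<1 (≤⇒≯ 0<q))
  where
  bound : sum π < (sum π + 1) * 2
  bound = ≤-trans (≤-reflexive (+-comm 1 (sum π))) (m≤m*n (sum π + 1) 2)

private
  ∈-boundedLists : ∀ m l π → All (_≤ m) π → length π ≤ l → π ∈ boundedLists m l
  ∈-boundedLists m zero    []      _          _         = here refl
  ∈-boundedLists m (suc l) []      _          _         = here refl
  ∈-boundedLists m (suc l) (x ∷ π) (x≤ ∷ π≤) (s≤s len≤) =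
    there (∈-cartesianProductWith⁺ _∷_ (∈-upTo⁺ (s≤s x≤)) (∈-boundedLists m l π π≤ len≤))

  boundedLists-unique : ∀ m l → Unique (boundedLists m l)
  boundedLists-unique m zero    = [] ∷ []
  boundedLists-unique m (suc l) =
    All.tabulate nonempty
    ∷ Unique.cartesianProductWith⁺ _∷_ ∷-injective (Unique.upTo⁺ (suc m)) (boundedLists-unique m l)
    where
    nonempty : ∀ {π} → π ∈ cartesianProductWith _∷_ (upTo (suc m)) (boundedLists m l) → ¬ [] ≡ π
    nonempty π∈ refl with ∈-cartesianProductWith⁻ _∷_ (upTo (suc m)) (boundedLists m l) π∈
    ... | _ , _ , _ , _ , ()

  length≤sum : ∀ {π} → All (0 <_) π → length π ≤ sum π
  length≤sum []          = z≤n
  length≤sum (0<x ∷ pos) = +-mono-≤ 0<x (length≤sum pos)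

∈-partitions : ∀ n π → π ∈ partitions n ⇔ IsPartition n π
∈-partitions n π = mk⇔ (λ π∈ → proj₂ (∈-filter⁻ (isPartition? n) {xs = boundedLists n n} π∈)) complete
  where
  complete : IsPartition n π → π ∈ partitions n
  complete p@(_ , pos , refl) = ∈-filter⁺ (isPartition? n)
    (∈-boundedLists n n π (All.tabulate ∈⇒≤sum) (length≤sum pos)) p

partitions-unique : ∀ n → Unique (partitions n)
partitions-unique n = Unique.filter⁺ (isPartition? n) (boundedLists-unique n n)

{-# OPTIONS --safe #-}

-- The meex of λ is twice the number of k ≥ 0 such that 2, 4, …, 2k are all parts of λ. With x = q²,
-- the partitions in P_od having these parts are generated by x^(k(k+1)/2) ∏ (1 + q^(2i-1)) / (1 - x^i),
-- whereas p_ed is generated by ∏ (1 + x^i) / (1 - q^(2i-1)). Clearing denominators, the theorem becomes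
-- Gauss's identity ∑ x^(k(k+1)/2) ∏ (1 - x^(2i-1)) = ∏ (1 - x^(2i)). It is proved modulo q^(n+1) by
-- Shanks' method: with v_s = ∏_{i ≤ s} (1 - x^(2i-1)) / (1 - x^(2i)) and F_m(z) = ∑_{s < m} v_s z^s,
-- telescoping gives (1 - xz) F_m(x²z) = (1 - z) F_m(z) + v_m (1 - x^(2m)) z^m, and by induction on m
-- F_m(x^(2m+1)) = v_m ∑_{k < 2m} x^(k(k+1)/2). For large m the left-hand side is 1 modulo q^(n+1).
module Submission where

-- Formal power series over the integers and their truncations as commutative rings.

module PowerSeries where

  open import Algebra.Bundles using (CommutativeRing)
  open import Algebra.Solver.Ring.AlmostCommutativeRing using (_-Raw-AlmostCommutative⟶_; fromCommutativeRing)
  open import Algebra.Structures using (IsCommutativeRing)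
  open import Data.Integer.Base as ℤ using (ℤ; 0ℤ; 1ℤ)
  import Data.Integer.Properties as ℤ
  open import Data.Integer.Solver using (module +-*-Solver)
  open import Data.Nat.Base using (ℕ; zero; suc; _≤_; z≤n; s≤s)
  open import Data.Nat.Properties using (≤-refl; ≤-trans; n≤1+n)
  open import Data.Product using (_,_)
  open import Function.Base using (_∘_)
  open import Level using (0ℓ)
  open import Relation.Binary.PropositionalEquality using (_≡_; refl; sym; trans; cong; cong₂)

  Series : Set
  Series = ℕ → ℤ

  infixl 6 _⊕_
  infixl 7 _⊛_

  -- Opaque because η would otherwise unfold f ⊕ g pointwise during unification.
  opaque
    _⊕_ : Series → Series → Series
    (f ⊕ g) n = f n ℤ.+ g n

    ⊖_ : Series → Series
    (⊖ f) n = ℤ.- f n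

    ⊕-at : ∀ f g n → (f ⊕ g) n ≡ f n ℤ.+ g n
    ⊕-at f g n = refl

  -- The Cauchy product, by recursion on the index: the constant coefficient of the left factor is
  -- split off and its tail is multiplied on.
  _⊛_ : Series → Series → Series
  (f ⊛ g) zero    = f 0 ℤ.* g 0
  (f ⊛ g) (suc n) = f 0 ℤ.* g (suc n) ℤ.+ ((f ∘ suc) ⊛ g) n

  const : ℤ → Series
  const c zero    = c
  const c (suc n) = 0ℤ

  -- Coefficient `n` of a product involves only coefficients up to `n` of the factors. This is what
  -- makes equality modulo q^(N+1) compatible with multiplication.
  ⊛-cong : ∀ n {f f′ g g′} → (∀ {i} → i ≤ n → f i ≡ f′ i) → (∀ {i} → i ≤ n → g i ≡ g′ i) →
           (f ⊛ g) n ≡ (f′ ⊛ g′) n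
  ⊛-cong zero    f≡ g≡ = cong₂ ℤ._*_ (f≡ z≤n) (g≡ z≤n)
  ⊛-cong (suc n) f≡ g≡ = cong₂ ℤ._+_ (cong₂ ℤ._*_ (f≡ z≤n) (g≡ ≤-refl))
    (⊛-cong n (f≡ ∘ s≤s) (λ i≤n → g≡ (≤-trans i≤n (n≤1+n n))))

  opaque
    unfolding _⊕_

    ⊛-distribʳ : ∀ n f g h → ((g ⊕ h) ⊛ f) n ≡ (g ⊛ f) n ℤ.+ (h ⊛ f) n
    ⊛-distribʳ zero    f g h = ℤ.*-distribʳ-+ (f 0) (g 0) (h 0)
    ⊛-distribʳ (suc n) f g h rewrite ⊛-distribʳ n f (g ∘ suc) (h ∘ suc) =
      solve 5 (λ a b c x y → (a :+ b) :* c :+ (x :+ y) := (a :* c :+ x) :+ (b :* c :+ y)) refl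
        (g 0) (h 0) (f (suc n)) _ _
      where open +-*-Solver

  ⊛-scale : ∀ n c f g → ((λ i → c ℤ.* f i) ⊛ g) n ≡ c ℤ.* (f ⊛ g) n
  ⊛-scale zero    c f g = ℤ.*-assoc c (f 0) (g 0)
  ⊛-scale (suc n) c f g rewrite ⊛-scale n c (f ∘ suc) g =
    solve 4 (λ c a b x → (c :* a) :* b :+ c :* x := c :* (a :* b :+ x)) refl c (f 0) (g (suc n)) _
    where open +-*-Solver

  -- The mirror image of the defining clause, splitting off the constant coefficient of the right
  -- factor; commutativity follows by playing the two against each other.
  ⊛-sucʳ : ∀ n f g → (f ⊛ g) (suc n) ≡ (f ⊛ (g ∘ suc)) n ℤ.+ f (suc n) ℤ.* g 0
  ⊛-sucʳ zero    f g = refl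
  ⊛-sucʳ (suc n) f g rewrite ⊛-sucʳ n (f ∘ suc) g = sym (ℤ.+-assoc (f 0 ℤ.* g (suc (suc n))) _ _)

  ⊛-comm : ∀ n f g → (f ⊛ g) n ≡ (g ⊛ f) n
  ⊛-comm zero    f g = ℤ.*-comm (f 0) (g 0)
  ⊛-comm (suc n) f g rewrite ⊛-sucʳ n g f | ⊛-comm n (f ∘ suc) g | ℤ.*-comm (f 0) (g (suc n)) =
    ℤ.+-comm (g (suc n) ℤ.* f 0) _

  opaque
    unfolding _⊕_

    ⊛-assoc : ∀ n f g h → ((f ⊛ g) ⊛ h) n ≡ (f ⊛ (g ⊛ h)) n
    ⊛-assoc zero    f g h = ℤ.*-assoc (f 0) (g 0) (h 0)
    -- By definition the tail of `f ⊛ g` is `f 0` times the tail of `g`, plus `(f ∘ suc) ⊛ g`;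
    -- multiplication by `h` is distributed over these two summands.
    ⊛-assoc (suc n) f g h
      rewrite ⊛-distribʳ n h (λ i → f 0 ℤ.* g (suc i)) ((f ∘ suc) ⊛ g)
            | ⊛-scale n (f 0) (g ∘ suc) h
            | ⊛-assoc n (f ∘ suc) g h =
      solve 5 (λ a b c x y → (a :* b) :* c :+ (a :* x :+ y) := a :* (b :* c :+ x) :+ y) refl
        (f 0) (g 0) (h (suc n)) _ _
      where open +-*-Solver

  const-⊛ : ∀ n c f → (const c ⊛ f) n ≡ c ℤ.* f n
  const-⊛ zero    c f = refl
  const-⊛ (suc n) c f = trans (cong₂ ℤ._+_ {x = c ℤ.* f (suc n)} refl (zero-⊛ n)) (ℤ.+-identityʳ _)
    where
    zero-⊛ : ∀ n → ((λ _ → 0ℤ) ⊛ f) n ≡ 0ℤ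
    zero-⊛ zero    = refl
    zero-⊛ (suc n) = trans (ℤ.+-identityˡ _) (zero-⊛ n)

  module Truncated (N : ℕ) where

    -- With this equality the series form the ring ℤ[[q]]/(q^(N+1)).
    record _≋_ (f g : Series) : Set where
      constructor agree
      field at : ∀ {n} → n ≤ N → f n ≡ g n
    open _≋_ public

    pointwise : ∀ {f g} → (∀ n → f n ≡ g n) → f ≋ g
    pointwise f≡g = agree λ {n} _ → f≡g n

    ⊛-identityˡ : ∀ n f → (const 1ℤ ⊛ f) n ≡ f n
    ⊛-identityˡ n f = trans (const-⊛ n 1ℤ f) (ℤ.*-identityˡ (f n))

    opaque
      unfolding _⊕_

      ⊕-⊛-isCommutativeRing : IsCommutativeRing _≋_ _⊕_ _⊛_ ⊖_ (const 0ℤ) (const 1ℤ)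
      ⊕-⊛-isCommutativeRing = record
        { isRing = record
          { +-isAbelianGroup = record
            { isGroup = record
              { isMonoid = record
                { isSemigroup = record
                  { isMagma = record
                    { isEquivalence = record
                      { refl  = pointwise λ _ → refl
                      ; sym   = λ p → agree (sym ∘ at p)
                      ; trans = λ p q → agree λ n≤N → trans (at p n≤N) (at q n≤N)
                      }
                    ; ∙-cong = λ p q → agree λ n≤N → cong₂ ℤ._+_ (at p n≤N) (at q n≤N)
                    }
                  ; assoc = λ f g h → pointwise λ n → ℤ.+-assoc (f n) (g n) (h n)
                  }
                ; identity = (λ f → pointwise λ { zero → ℤ.+-identityˡ _ ; (suc n) → ℤ.+-identityˡ _ })
                           , (λ f → pointwise λ { zero → ℤ.+-identityʳ _ ; (suc n) → ℤ.+-identityʳ _ })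
                }
              ; inverse = (λ f → pointwise λ { zero → ℤ.+-inverseˡ (f 0) ; (suc n) → ℤ.+-inverseˡ (f (suc n)) })
                        , (λ f → pointwise λ { zero → ℤ.+-inverseʳ (f 0) ; (suc n) → ℤ.+-inverseʳ (f (suc n)) })
              ; ⁻¹-cong = λ p → agree λ n≤N → cong ℤ.-_ (at p n≤N)
              }
            ; comm = λ f g → pointwise λ n → ℤ.+-comm (f n) (g n)
            }
          ; *-cong = λ p q → agree λ {n} n≤N →
              ⊛-cong n (λ i≤n → at p (≤-trans i≤n n≤N)) (λ i≤n → at q (≤-trans i≤n n≤N))
          ; *-assoc = λ f g h → pointwise λ n → ⊛-assoc n f g h
          ; *-identity = (λ f → pointwise λ n → ⊛-identityˡ n f)
                       , (λ f → pointwise λ n → trans (⊛-comm n f _) (⊛-identityˡ n f))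
          ; distrib = (λ f g h → pointwise λ n → trans (⊛-comm n f (g ⊕ h))
                        (trans (⊛-distribʳ n f g h) (cong₂ ℤ._+_ (⊛-comm n g f) (⊛-comm n h f))))
                    , (λ f g h → pointwise λ n → ⊛-distribʳ n f g h)
          }
        ; *-comm = λ f g → pointwise λ n → ⊛-comm n f g
        }

      const-homo-+ : ∀ a b → const (a ℤ.+ b) ≋ (const a ⊕ const b)
      const-homo-+ a b = pointwise λ { zero → refl ; (suc n) → refl }

      const-homo-⊖ : ∀ a → const (ℤ.- a) ≋ (⊖ const a)
      const-homo-⊖ a = pointwise λ { zero → refl ; (suc n) → refl }

    ring : CommutativeRing 0ℓ 0ℓ
    ring = record { isCommutativeRing = ⊕-⊛-isCommutativeRing }

    -- The coefficient homomorphism through which the ring solver can use integer constants in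
    -- identities between series.
    constants : ℤ.+-*-rawRing -Raw-AlmostCommutative⟶ fromCommutativeRing ring
    constants = record
      { ⟦_⟧    = const
      ; +-homo = const-homo-+
      ; *-homo = λ a b → pointwise λ n → sym (trans (const-⊛ n a (const b)) (scaled n a b))
      ; -‿homo = const-homo-⊖
      ; 0-homo = pointwise λ _ → refl
      ; 1-homo = pointwise λ _ → refl
      }
      where
      scaled : ∀ n a b → a ℤ.* const b n ≡ const (a ℤ.* b) n
      scaled zero    a b = refl
      scaled (suc n) a b = ℤ.*-zeroʳ a

-- Finite sums and products of truncated series, and cancellation.

module GeneratingFunctions where

  open PowerSeries
  open import Algebra.Bundles using (CommutativeRing)
  import Algebra.Properties.CommutativeSemiring.Exp as Exp
  import Algebra.Solver.Ring
  open import Algebra.Solver.Ring.AlmostCommutativeRing using (fromCommutativeRing)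
  open import Data.Integer.Base as ℤ using (0ℤ; 1ℤ)
  import Data.Integer.Properties as ℤ
  open import Data.List.Base using (List; []; _∷_; map; downFrom)
  open import Data.Maybe.Base using (Maybe; just; nothing)
  open import Data.Nat.Base as ℕ using (ℕ; zero; suc; _≤_; _<_; s≤s; _⊓_)
  import Data.Nat.Properties as ℕ
  open import Data.Nat.Divisibility using (_∣_; _∣?_; n∣m*n; ∣m+n∣m⇒∣n; ∣1⇒≡1)
  open import Relation.Nullary using (¬_; yes; no; contradiction)
  import Relation.Binary.Reasoning.Setoid as SetoidReasoning
  open import Relation.Binary.PropositionalEquality as ≡ using (_≡_)

  module GF (N : ℕ) where

    open Truncated N public
    open CommutativeRing ring public hiding (ring)
    open Exp commutativeSemiring public
    open SetoidReasoning setoid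

    const-≟ : ∀ a b → Maybe (const a ≈ const b)
    const-≟ a b with a ℤ.≟ b
    ... | yes a≡b = just (reflexive (≡.cong const a≡b))
    ... | no  _   = nothing

    open Algebra.Solver.Ring ℤ.+-*-rawRing (fromCommutativeRing ring) constants const-≟
      using (solve; _:=_; _:+_; _:*_; _:-_; con)

    Σ< Π< : ℕ → (ℕ → Series) → Series
    Σ< zero    f = 0#
    Σ< (suc n) f = Σ< n f + f n
    Π< zero    f = 1#
    Π< (suc n) f = Π< n f * f n

    Σ<-cong : ∀ n {f g} → (∀ {i} → i < n → f i ≈ g i) → Σ< n f ≈ Σ< n g
    Σ<-cong zero    f≈g = refl
    Σ<-cong (suc n) f≈g = +-cong (Σ<-cong n (λ i<n → f≈g (ℕ.m≤n⇒m≤1+n i<n))) (f≈g ℕ.≤-refl)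

    Σ<-distribʳ : ∀ n f c → Σ< n f * c ≈ Σ< n (λ i → f i * c)
    Σ<-distribʳ zero    f c = zeroˡ c
    Σ<-distribʳ (suc n) f c = trans (distribʳ c _ _) (+-congʳ (Σ<-distribʳ n f c))

    Σ<-truncate : ∀ d n {f} → (∀ {i} → n ≤ i → f i ≈ 0#) → Σ< (d ℕ.+ n) f ≈ Σ< n f
    Σ<-truncate zero    n f≈0 = refl
    Σ<-truncate (suc d) n f≈0 =
      trans (+-cong (Σ<-truncate d n f≈0) (f≈0 (ℕ.m≤n+m n d))) (+-identityʳ _)

    Π<-cong : ∀ n {f g} → (∀ i → f i ≈ g i) → Π< n f ≈ Π< n g
    Π<-cong zero    f≈g = refl
    Π<-cong (suc n) f≈g = *-cong (Π<-cong n f≈g) (f≈g n)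

    Π<-* : ∀ n f g → Π< n f * Π< n g ≈ Π< n (λ i → f i * g i)
    Π<-* zero    f g = *-identityˡ 1#
    Π<-* (suc n) f g = trans
      (solve 4 (λ a b c d → (a :* b) :* (c :* d) := (a :* c) :* (b :* d)) refl (Π< n f) (f n) (Π< n g) (g n))
      (*-congʳ (Π<-* n f g))

    -- For `N > 0` the truncated ring has zero divisors, so each factor to be cancelled has to be
    -- justified, here by exhibiting an inverse.
    Cancellable : Series → Set
    Cancellable d = ∀ a b → a * d ≈ b * d → a ≈ b

    inverse⇒cancellable : ∀ {d} e → e * d ≈ 1# → Cancellable d
    inverse⇒cancellable {d} e ed≈1 a b ad≈bd = begin
      a           ≈⟨ *-identityʳ a ⟨
      a * 1#      ≈⟨ *-congˡ ed≈1 ⟨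
      a * (e * d) ≈⟨ solve 3 (λ a e d → a :* (e :* d) := (a :* d) :* e) refl a e d ⟩
      (a * d) * e ≈⟨ *-congʳ ad≈bd ⟩
      (b * d) * e ≈⟨ solve 3 (λ a e d → a :* (e :* d) := (a :* d) :* e) refl b e d ⟨
      b * (e * d) ≈⟨ *-congˡ ed≈1 ⟩
      b * 1#      ≈⟨ *-identityʳ b ⟩
      b           ∎

    *-cancellable : ∀ {d e} → Cancellable d → Cancellable e → Cancellable (d * e)
    *-cancellable cd ce a b eq = cd a b (ce _ _ (trans (*-assoc a _ _) (trans eq (sym (*-assoc b _ _)))))

    Π<-cancellable : ∀ n {f} → (∀ i → Cancellable (f i)) → Cancellable (Π< n f)
    Π<-cancellable zero    cf a b eq = trans (sym (*-identityʳ a)) (trans eq (*-identityʳ b))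
    Π<-cancellable (suc n) cf = *-cancellable (Π<-cancellable n cf) (cf n)

    -- Gauss's identity by Shanks' method.

    -- This is x^(k(k+1)/2); the product form avoids the division by two.
    θ : Series → ℕ → Series
    θ x k = Π< k (λ i → x ^ suc i)

    -- v s = (x;x²)_s / (x²;x²)_s in q-Pochhammer notation, so F m is a partial sum of the
    -- series in the q-binomial theorem; F-partial is Shanks' finite form of Gauss's identity.
    module Shanks (x : Series) (h : ℕ → Series) (h-inverse : ∀ n → h n * (1# - x * x * (x * x) ^ n) ≈ 1#) where

      -- Thus `x * X n` is x^(2n+1) and `x * x * X n` is x^(2n+2), the odd and even powers in the
      -- products.
      X : ℕ → Series
      X n = (x * x) ^ n

      v : ℕ → Series
      v zero    = 1#
      v (suc s) = v s * (1# - x * X s) * h s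

      v-step : ∀ s → v (suc s) * (1# - x * x * X s) ≈ v s * (1# - x * X s)
      v-step s = trans (*-assoc _ (h s) _) (trans (*-congˡ (h-inverse s)) (*-identityʳ _))

      F : ℕ → Series → Series
      F m z = Σ< m (λ s → v s * z ^ s)

      F-cong : ∀ m {y z} → y ≈ z → F m y ≈ F m z
      F-cong m y≈z = Σ<-cong m (λ {s} _ → *-congˡ (^-congˡ s y≈z))

      -- Induction on `m`: the old boundary term and the new summand on the left combine into the
      -- new summand on the right and a remainder, which `v-step` recognises as the next boundary
      -- term.
      F-functional : ∀ m z → (1# - x * z) * F m (x * x * z) ≈ (1# - z) * F m z + v m * (1# - X m) * z ^ m
      F-functional zero z =
        solve 2 (λ x z → (con 1ℤ :- x :* z) :* con 0ℤ
                    := (con 1ℤ :- z) :* con 0ℤ :+ con 1ℤ :* (con 1ℤ :- con 1ℤ) :* con 1ℤ) refl x z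
      F-functional (suc m) z = begin
        (1# - x * z) * (F m (x * x * z) + v m * (x * x * z) ^ m)
          ≈⟨ *-congˡ (+-congˡ (*-congˡ (^-distrib-* (x * x) z m))) ⟩
        (1# - x * z) * (F m (x * x * z) + v m * (X m * z ^ m))
          ≈⟨ distribˡ _ _ _ ⟩
        (1# - x * z) * F m (x * x * z) + (1# - x * z) * (v m * (X m * z ^ m))
          ≈⟨ +-congʳ (F-functional m z) ⟩
        ((1# - z) * F m z + v m * (1# - X m) * z ^ m) + (1# - x * z) * (v m * (X m * z ^ m))
          ≈⟨ solve 6 (λ x z f v X Z →
               ((con 1ℤ :- z) :* f :+ v :* (con 1ℤ :- X) :* Z) :+ (con 1ℤ :- x :* z) :* (v :* (X :* Z))
               := (con 1ℤ :- z) :* (f :+ v :* Z) :+ (v :* (con 1ℤ :- x :* X)) :* (z :* Z))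
               refl x z (F m z) (v m) (X m) (z ^ m) ⟩
        (1# - z) * (F m z + v m * z ^ m) + v m * (1# - x * X m) * (z * z ^ m)
          ≈⟨ +-congˡ (*-congʳ (v-step m)) ⟨
        (1# - z) * F (suc m) z + v (suc m) * (1# - X (suc m)) * z ^ suc m ∎

      x^[n*2] : ∀ n → x ^ (n ℕ.* 2) ≈ X n
      x^[n*2] zero    = refl
      x^[n*2] (suc n) = trans (sym (*-assoc x x _)) (*-congˡ (x^[n*2] n))

      -- The exponent is the triangular number 2n(2n+1)/2 = n(2n+1).
      θ-even : ∀ n → θ x (n ℕ.* 2) ≈ (x * X n) ^ n
      θ-even zero    = refl
      θ-even (suc n) = begin
        θ x (n ℕ.* 2) * (x * x ^ (n ℕ.* 2)) * (x * (x * x ^ (n ℕ.* 2)))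
          ≈⟨ *-cong (*-cong (θ-even n) (*-congˡ (x^[n*2] n))) (*-congˡ (*-congˡ (x^[n*2] n))) ⟩
        (x * X n) ^ n * (x * X n) * (x * (x * X n))
          ≈⟨ solve 3 (λ x X Z → Z :* (x :* X) :* (x :* (x :* X)) := (x :* x :* X) :* ((x :* X) :* Z))
               refl x (X n) ((x * X n) ^ n) ⟩
        X (suc n) * (x * X n) ^ suc n
          ≈⟨ ^-distrib-* (x * x) (x * X n) (suc n) ⟨
        (x * x * (x * X n)) ^ suc n
          ≈⟨ ^-congˡ (suc n) (solve 2 (λ x X → x :* x :* (x :* X) := x :* (x :* x :* X)) refl x (X n)) ⟩
        (x * X (suc n)) ^ suc n ∎

      F-partial : ∀ n → F n (x * X n) ≈ v n * Σ< (n ℕ.* 2) (θ x)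
      F-partial zero    = sym (zeroʳ _)
      -- Both sides are compared after multiplication by 1 - x^(2n+2), the new denominator of
      -- `v (suc n)`. With z = x^(2n+1) the argument x^(2n+3) is `x * x * z`, so the functional
      -- equation at `z` applies.
      F-partial (suc n) = inverse⇒cancellable (h n) (h-inverse n) _ _ (begin
        F (suc n) (x * X (suc n)) * (1# - x * x * X n)
          ≈⟨ *-comm _ _ ⟩
        (1# - x * x * X n) * F (suc n) (x * X (suc n))
          ≈⟨ *-cong (+-congˡ (-‿cong (*-assoc x x (X n))))
               (F-cong (suc n) (solve 2 (λ x X → x :* (x :* x :* X) := x :* x :* (x :* X)) refl x (X n))) ⟩
        (1# - x * z) * F (suc n) (x * x * z)
          ≈⟨ F-functional (suc n) z ⟩
        (1# - z) * (F n z + v n * z ^ n) + v (suc n) * (1# - x * x * X n) * (z * z ^ n)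
          ≈⟨ +-cong (*-congˡ (+-congʳ (F-partial n))) (*-congʳ (v-step n)) ⟩
        (1# - z) * (v n * S + v n * z ^ n) + v n * (1# - z) * (z * z ^ n)
          ≈⟨ solve 4 (λ z v S Z → (con 1ℤ :- z) :* (v :* S :+ v :* Z) :+ v :* (con 1ℤ :- z) :* (z :* Z)
                               := v :* (con 1ℤ :- z) :* (S :+ Z :+ Z :* z)) refl z (v n) S (z ^ n) ⟩
        -- By `θ-even` the two added powers are `θ x (n * 2)` and `θ x (1 + n * 2)`: one comes from
        -- the last summand of `F (suc n) z`, the other from the boundary term.
        v n * (1# - z) * (S + z ^ n + z ^ n * z)
          ≈⟨ *-cong (v-step n) (+-cong (+-congˡ (θ-even n)) (*-cong (θ-even n) (*-congˡ (x^[n*2] n)))) ⟨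
        v (suc n) * (1# - x * x * X n) * Σ< (suc n ℕ.* 2) (θ x)
          ≈⟨ solve 3 (λ a b c → a :* b :* c := a :* c :* b) refl _ _ _ ⟩
        v (suc n) * Σ< (suc n ℕ.* 2) (θ x) * (1# - x * x * X n) ∎)
        where
        z = x * X n
        S = Σ< (n ℕ.* 2) (θ x)

      F-zero : ∀ n {z} → z ≈ 0# → F (suc n) z ≈ 1#
      F-zero zero    z≈0 = solve 0 (con 0ℤ :+ con 1ℤ :* con 1ℤ := con 1ℤ) refl
      F-zero (suc n) {z} z≈0 = trans
        (+-cong (F-zero n z≈0) (trans (*-congˡ (trans (*-congʳ z≈0) (zeroˡ _))) (zeroʳ _)))
        (+-identityʳ 1#)

      v-Π : ∀ n → v n * Π< n (λ i → 1# - x * x * X i) ≈ Π< n (λ i → 1# - x * X i)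
      v-Π zero    = *-identityˡ 1#
      v-Π (suc n) = begin
        v (suc n) * (P * (1# - x * x * X n))
          ≈⟨ solve 3 (λ a b c → a :* (b :* c) := (a :* c) :* b) refl _ _ _ ⟩
        v (suc n) * (1# - x * x * X n) * P
          ≈⟨ *-congʳ (v-step n) ⟩
        v n * (1# - x * X n) * P
          ≈⟨ solve 3 (λ a b c → a :* c :* b := (a :* b) :* c) refl _ _ _ ⟩
        v n * P * (1# - x * X n)
          ≈⟨ *-congʳ (v-Π n) ⟩
        Π< (suc n) (λ i → 1# - x * X i) ∎
        where P = Π< n (λ i → 1# - x * x * X i)

      -- When x^(2n+3) vanishes, the left-hand side of `F-partial` for `suc n` reduces to its
      -- constant term 1. So `v (suc n)` is inverse to the sum of triangular powers, and `v-Π`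
      -- expresses it as a quotient of products.
      gauss : ∀ n → x * X (suc n) ≈ 0# →
              Σ< (suc n ℕ.* 2) (θ x) * Π< (suc n) (λ i → 1# - x * X i) ≈ Π< (suc n) (λ i → 1# - x * x * X i)
      gauss n xX≈0 = begin
        S * Π< (suc n) (λ i → 1# - x * X i)
          ≈⟨ *-congˡ (v-Π (suc n)) ⟨
        S * (v (suc n) * P)
          ≈⟨ solve 3 (λ a b c → a :* (b :* c) := (b :* a) :* c) refl S (v (suc n)) P ⟩
        (v (suc n) * S) * P
          ≈⟨ *-congʳ (F-partial (suc n)) ⟨
        F (suc n) (x * X (suc n)) * P
          ≈⟨ *-congʳ (F-zero n xX≈0) ⟩
        1# * P
          ≈⟨ *-identityˡ P ⟩
        P ∎
        where
        S = Σ< (suc n ℕ.* 2) (θ x)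
        P = Π< (suc n) (λ i → 1# - x * x * X i)

    -- Generating functions of partitions with prescribed multiplicities.

    multiplicityGF : List ℕ → Series → Series
    multiplicityGF []      y = 0#
    multiplicityGF (j ∷ J) y = y ^ j + multiplicityGF J y

    partsGF : Series → (ℕ → List ℕ) → ℕ → Series
    partsGF q J zero    = 1#
    partsGF q J (suc m) = multiplicityGF (J (suc m)) (q ^ suc m) * partsGF q J m

    -- Multiplicities above N are irrelevant modulo q^(N+1).
    anyMultiplicity atMostOnce atLeastOnce : List ℕ
    anyMultiplicity = downFrom (suc N)
    atMostOnce      = 1 ∷ 0 ∷ []
    atLeastOnce     = map suc anyMultiplicity

    -- The condition that the meex exceeds 2k: every even part up to 2k occurs.
    podMultiplicities : ℕ → ℕ → List ℕ
    podMultiplicities k p with 2 ∣? p | p ℕ.≤? k ℕ.* 2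
    ... | no  _ | _     = atMostOnce
    ... | yes _ | yes _ = atLeastOnce
    ... | yes _ | no  _ = anyMultiplicity

    pedMultiplicities : ℕ → List ℕ
    pedMultiplicities p with 2 ∣? p
    ... | no  _ = anyMultiplicity
    ... | yes _ = atMostOnce

    1+n*2-odd : ∀ n → ¬ 2 ∣ suc (n ℕ.* 2)
    1+n*2-odd n 2∣ with () ← ∣1⇒≡1 (∣m+n∣m⇒∣n (≡.subst (2 ∣_) (ℕ.+-comm 1 (n ℕ.* 2)) 2∣) (n∣m*n n))

    pod-odd : ∀ k i → podMultiplicities k (suc (i ℕ.* 2)) ≡ atMostOnce
    pod-odd k i with 2 ∣? suc (i ℕ.* 2)
    ... | no  _  = ≡.refl
    ... | yes 2∣ = contradiction 2∣ (1+n*2-odd i)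

    pod-even-≤ : ∀ k i → i ≤ k → podMultiplicities k (i ℕ.* 2) ≡ atLeastOnce
    pod-even-≤ k i i≤k with 2 ∣? (i ℕ.* 2) | i ℕ.* 2 ℕ.≤? k ℕ.* 2
    ... | no 2∤ | _      = contradiction (n∣m*n i) 2∤
    ... | yes _ | yes _  = ≡.refl
    ... | yes _ | no ≰   = contradiction (ℕ.*-monoˡ-≤ 2 i≤k) ≰

    pod-even-> : ∀ k i → k < i → podMultiplicities k (i ℕ.* 2) ≡ anyMultiplicity
    pod-even-> k i k<i with 2 ∣? (i ℕ.* 2) | i ℕ.* 2 ℕ.≤? k ℕ.* 2
    ... | no 2∤ | _      = contradiction (n∣m*n i) 2∤
    ... | yes _ | yes ≤  = contradiction (ℕ.*-cancelʳ-≤ i k 2 ≤) (ℕ.<⇒≱ k<i)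
    ... | yes _ | no _   = ≡.refl

    ped-odd : ∀ i → pedMultiplicities (suc (i ℕ.* 2)) ≡ anyMultiplicity
    ped-odd i with 2 ∣? suc (i ℕ.* 2)
    ... | no  _  = ≡.refl
    ... | yes 2∣ = contradiction 2∣ (1+n*2-odd i)

    ped-even : ∀ i → pedMultiplicities (i ℕ.* 2) ≡ atMostOnce
    ped-even i with 2 ∣? (i ℕ.* 2)
    ... | no 2∤ = contradiction (n∣m*n i) 2∤
    ... | yes _ = ≡.refl

    geometric : ∀ n y → multiplicityGF (downFrom n) y * (1# - y) ≈ 1# - y ^ n
    geometric zero    y = solve 1 (λ y → con 0ℤ :* (con 1ℤ :- y) := con 1ℤ :- con 1ℤ) refl y
    geometric (suc n) y = begin
      (y ^ n + G) * (1# - y)                ≈⟨ distribʳ _ _ _ ⟩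
      y ^ n * (1# - y) + G * (1# - y)       ≈⟨ +-congˡ (geometric n y) ⟩
      y ^ n * (1# - y) + (1# - y ^ n)
        ≈⟨ solve 2 (λ y z → z :* (con 1ℤ :- y) :+ (con 1ℤ :- z) := con 1ℤ :- y :* z) refl y (y ^ n) ⟩
      1# - y ^ suc n                        ∎
      where G = multiplicityGF (downFrom n) y

    atMostOnceGF : ∀ y → multiplicityGF atMostOnce y ≈ 1# + y
    atMostOnceGF = solve 1 (λ y → y :* con 1ℤ :+ (con 1ℤ :+ con 0ℤ) := con 1ℤ :+ y) refl

    map-suc-GF : ∀ J y → multiplicityGF (map suc J) y ≈ y * multiplicityGF J y
    map-suc-GF []      y = sym (zeroʳ y)
    map-suc-GF (j ∷ J) y = trans (+-congˡ (map-suc-GF J y)) (sym (distribˡ y _ _))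

    -- Product formulas for both families of partitions and their comparison.

    module Nilpotent (q : Series) (nilpotent : q ^ suc N ≈ 0#) where

      x : Series
      x = q * q

      X o : ℕ → Series
      X n = (x * x) ^ n
      o n = q ^ suc (n ℕ.* 2)

      multiple-nilpotent : ∀ {y} w → y ≈ q * w → y ^ suc N ≈ 0#
      multiple-nilpotent {y} w y≈qw = begin
        y ^ suc N             ≈⟨ ^-congˡ (suc N) y≈qw ⟩
        (q * w) ^ suc N       ≈⟨ ^-distrib-* q w (suc N) ⟩
        q ^ suc N * w ^ suc N ≈⟨ *-congʳ nilpotent ⟩
        0# * w ^ suc N        ≈⟨ zeroˡ _ ⟩
        0#                    ∎

      -- The finite geometric sum is an exact inverse of `1# - y`, because a multiple of `q` has
      -- vanishing power N+1.
      anyMultiplicityGF : ∀ {y} w → y ≈ q * w → multiplicityGF anyMultiplicity y * (1# - y) ≈ 1#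
      anyMultiplicityGF {y} w y≈qw = begin
        multiplicityGF anyMultiplicity y * (1# - y) ≈⟨ geometric (suc N) y ⟩
        1# - y ^ suc N                              ≈⟨ +-congˡ (-‿cong (multiple-nilpotent w y≈qw)) ⟩
        1# - 0#                                     ≈⟨ solve 0 (con 1ℤ :- con 0ℤ := con 1ℤ) refl ⟩
        1#                                          ∎

      q^[n*2] : ∀ n → q ^ (n ℕ.* 2) ≈ x ^ n
      q^[n*2] zero    = refl
      q^[n*2] (suc n) = trans (sym (*-assoc q q _)) (*-congˡ (q^[n*2] n))

      q∣x^[1+n] : ∀ n → x ^ suc n ≈ q * (q * x ^ n)
      q∣x^[1+n] n = *-assoc q q _

      x^n*x^n : ∀ n → x ^ n * x ^ n ≈ X n
      x^n*x^n n = sym (^-distrib-* x x n)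

      -- Parts are added in pairs. The odd part 2n+1 contributes 1 + q^(2n+1); the even part 2n+2
      -- contributes the inverse of 1 - x^(n+1), with an extra factor x^(n+1) if it is forced to
      -- occur, that is, if n+1 ≤ k. The extra factors accumulate to `θ x (n ⊓ k)`.
      pod-GF : ∀ k n → partsGF q (podMultiplicities k) (n ℕ.* 2) * Π< n (λ i → 1# - x ^ suc i)
                     ≈ Π< n (λ i → 1# + o i) * θ x (n ⊓ k)
      pod-GF k zero    = refl
      pod-GF k (suc n) = begin
        (M * (multiplicityGF (podMultiplicities k (suc (n ℕ.* 2))) (o n) * G)) * (P * (1# - x ^ suc n))
          ≈⟨ *-congʳ (*-congˡ (*-congʳ (trans (reflexive (≡.cong (λ J → multiplicityGF J (o n)) (pod-odd k n)))
               (atMostOnceGF (o n))))) ⟩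
        (M * ((1# + o n) * G)) * (P * (1# - x ^ suc n))
          ≈⟨ solve 5 (λ M u G P w → (M :* (u :* G)) :* (P :* w) := (G :* P) :* u :* (M :* w)) refl M (1# + o n) G P _ ⟩
        (G * P) * (1# + o n) * (M * (1# - x ^ suc n))
          ≈⟨ *-congʳ (*-congʳ (pod-GF k n)) ⟩
        (Q * θ x (n ⊓ k)) * (1# + o n) * (M * (1# - x ^ suc n))
          ≈⟨ solve 4 (λ Q t u w → (Q :* t) :* u :* w := Q :* u :* (t :* w)) refl Q (θ x (n ⊓ k)) (1# + o n) _ ⟩
        Q * (1# + o n) * (θ x (n ⊓ k) * (M * (1# - x ^ suc n)))
          ≈⟨ *-congˡ even-part ⟩
        Q * (1# + o n) * θ x (suc n ⊓ k) ∎
        where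
        M = multiplicityGF (podMultiplicities k (suc n ℕ.* 2)) (q ^ (suc n ℕ.* 2))
        G = partsGF q (podMultiplicities k) (n ℕ.* 2)
        P = Π< n (λ i → 1# - x ^ suc i)
        Q = Π< n (λ i → 1# + o i)

        y = q ^ (suc n ℕ.* 2)

        any-inverse : multiplicityGF anyMultiplicity y * (1# - x ^ suc n) ≈ 1#
        any-inverse = trans (*-congˡ (+-congˡ (-‿cong (sym (q^[n*2] (suc n)))))) (anyMultiplicityGF _ refl)

        even-part : θ x (n ⊓ k) * (M * (1# - x ^ suc n)) ≈ θ x (suc n ⊓ k)
        even-part with suc n ℕ.≤? k
        ... | yes n<k rewrite ℕ.m≤n⇒m⊓n≡m n<k | ℕ.m≤n⇒m⊓n≡m (ℕ.<⇒≤ n<k) | pod-even-≤ k (suc n) n<k =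
          *-congˡ (begin
            multiplicityGF atLeastOnce y * (1# - x ^ suc n)           ≈⟨ *-congʳ (map-suc-GF anyMultiplicity y) ⟩
            (y * multiplicityGF anyMultiplicity y) * (1# - x ^ suc n) ≈⟨ *-assoc _ _ _ ⟩
            y * (multiplicityGF anyMultiplicity y * (1# - x ^ suc n)) ≈⟨ *-cong (q^[n*2] (suc n)) any-inverse ⟩
            x ^ suc n * 1#                                            ≈⟨ *-identityʳ _ ⟩
            x ^ suc n                                                 ∎)
        ... | no n≮k rewrite ℕ.m≥n⇒m⊓n≡n (ℕ.≮⇒≥ n≮k) | ℕ.m≥n⇒m⊓n≡n (ℕ.m≤n⇒m≤1+n (ℕ.≮⇒≥ n≮k))
                           | pod-even-> k (suc n) (s≤s (ℕ.≮⇒≥ n≮k)) =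
          trans (*-congˡ any-inverse) (*-identityʳ _)

      -- The same pairing of parts, but now the odd part gives a geometric series and the even part
      -- a binomial.
      ped-GF : ∀ n → partsGF q pedMultiplicities (n ℕ.* 2) * Π< n (λ i → 1# - o i) ≈ Π< n (λ i → 1# + x ^ suc i)
      ped-GF zero    = *-identityˡ 1#
      ped-GF (suc n) rewrite ped-even (suc n) | ped-odd n = begin
        (M * (A * G)) * (P * (1# - o n))
          ≈⟨ solve 5 (λ M u G P w → (M :* (u :* G)) :* (P :* w) := (G :* P) :* M :* (u :* w)) refl M A G P _ ⟩
        (G * P) * M * (A * (1# - o n))
          ≈⟨ *-cong (*-cong (ped-GF n) (trans (atMostOnceGF _) (+-congˡ (q^[n*2] (suc n)))))
                    (anyMultiplicityGF _ refl) ⟩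
        Π< (suc n) (λ i → 1# + x ^ suc i) * 1#
          ≈⟨ *-identityʳ _ ⟩
        Π< (suc n) (λ i → 1# + x ^ suc i) ∎
        where
        M = multiplicityGF atMostOnce (q ^ (suc n ℕ.* 2))
        A = multiplicityGF anyMultiplicity (o n)
        G = partsGF q pedMultiplicities (n ℕ.* 2)
        P = Π< n (λ i → 1# - o i)

      difference-of-squares : ∀ n (f : ℕ → Series) {g : ℕ → Series} → (∀ i → f i * f i ≈ g i) →
                              Π< n (λ i → 1# + f i) * Π< n (λ i → 1# - f i) ≈ Π< n (λ i → 1# - g i)
      difference-of-squares n f f²≈g = trans (Π<-* n _ _) (Π<-cong n λ i → trans
        (solve 1 (λ a → (con 1ℤ :+ a) :* (con 1ℤ :- a) := con 1ℤ :- a :* a) refl (f i))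
        (+-congˡ (-‿cong (f²≈g i))))

      o-squared : ∀ n → o n * o n ≈ x * X n
      o-squared n = begin
        (q * q ^ (n ℕ.* 2)) * (q * q ^ (n ℕ.* 2)) ≈⟨ *-cong (*-congˡ (q^[n*2] n)) (*-congˡ (q^[n*2] n)) ⟩
        (q * x ^ n) * (q * x ^ n)  ≈⟨ solve 2 (λ q z → (q :* z) :* (q :* z) := (q :* q) :* (z :* z)) refl q (x ^ n) ⟩
        x * (x ^ n * x ^ n)        ≈⟨ *-congˡ (x^n*x^n n) ⟩
        x * X n                    ∎

      x^[1+n]-squared : ∀ n → x ^ suc n * x ^ suc n ≈ x * x * X n
      x^[1+n]-squared n = x^n*x^n (suc n)

      -- The last factor x^k of the product already vanishes, since k > N.
      θ-vanishes : ∀ {k} → suc N ≤ k → θ x k ≈ 0#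
      θ-vanishes {suc k} N<k = begin
        θ x k * x ^ suc k                       ≈⟨ *-congˡ (^-congʳ x (≡.sym (ℕ.m+[n∸m]≡n N<k))) ⟩
        θ x k * x ^ (suc N ℕ.+ (k ℕ.∸ N))       ≈⟨ *-congˡ (^-homo-* x (suc N) (k ℕ.∸ N)) ⟩
        θ x k * (x ^ suc N * x ^ (k ℕ.∸ N))     ≈⟨ *-congˡ (*-congʳ (multiple-nilpotent q refl)) ⟩
        θ x k * (0# * x ^ (k ℕ.∸ N))            ≈⟨ solve 2 (λ a b → a :* (con 0ℤ :* b) := con 0ℤ) refl (θ x k) _ ⟩
        0#                                      ∎

      -- Multiplication by the invertible products `E` and `O` clears all denominators. The
      -- differences of squares then leave the odd powers of x on one side and the even powers on
      -- the other, as in Gauss's identity.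
      pod-ped-identity : Σ< (suc N) (λ k → partsGF q (podMultiplicities k) (suc N ℕ.* 2))
                         ≈ partsGF q pedMultiplicities (suc N ℕ.* 2)
      pod-ped-identity = *-cancellable
        (Π<-cancellable M (λ i → inverse⇒cancellable _ (anyMultiplicityGF _ (q∣x^[1+n] i))))
        (Π<-cancellable M (λ i → inverse⇒cancellable _ (anyMultiplicityGF _ refl))) _ _ (begin
        Σ< M (λ k → Pod k) * (E * O)
          ≈⟨ *-assoc _ E O ⟨
        Σ< M (λ k → Pod k) * E * O
          ≈⟨ *-congʳ (Σ<-distribʳ M _ E) ⟩
        Σ< M (λ k → Pod k * E) * O
          ≈⟨ *-congʳ (Σ<-cong M λ {k} k<M → trans (pod-GF k M) (trans
               (*-congˡ (reflexive (≡.cong (θ x) (ℕ.m≥n⇒m⊓n≡n (ℕ.<⇒≤ k<M))))) (*-comm _ _))) ⟩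
        Σ< M (λ k → θ x k * O⁺) * O
          ≈⟨ *-congʳ (Σ<-distribʳ M (θ x) O⁺) ⟨
        Σ< M (θ x) * O⁺ * O
          ≈⟨ *-assoc _ O⁺ O ⟩
        Σ< M (θ x) * (O⁺ * O)
          ≈⟨ *-congˡ (difference-of-squares M o o-squared) ⟩
        Σ< M (θ x) * Π< M (λ i → 1# - x * X i)
          -- `gauss` has twice as many summands as factors; the summands added here are zero.
          ≈⟨ *-congʳ (Σ<-truncate M M θ-vanishes) ⟨
        Σ< (M ℕ.+ M) (θ x) * Π< M (λ i → 1# - x * X i)
          ≈⟨ *-congʳ (reflexive (≡.cong (λ n → Σ< n (θ x))
               (≡.trans (≡.cong (M ℕ.+_) (≡.sym (ℕ.+-identityʳ M))) (ℕ.*-comm 2 M)))) ⟩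
        Σ< (M ℕ.* 2) (θ x) * Π< M (λ i → 1# - x * X i)
          ≈⟨ gauss N (trans (*-congˡ (multiple-nilpotent (q * x) (*-assoc q q x))) (zeroʳ x)) ⟩
        Π< M (λ i → 1# - x * x * X i)
          ≈⟨ difference-of-squares M (λ i → x ^ suc i) x^[1+n]-squared ⟨
        Π< M (λ i → 1# + x ^ suc i) * E
          ≈⟨ *-congʳ (ped-GF M) ⟨
        Ped * O * E
          ≈⟨ solve 3 (λ a b c → a :* b :* c := a :* (c :* b)) refl Ped O E ⟩
        Ped * (E * O) ∎)
        where
        M = suc N
        Pod : ℕ → Series
        Pod k = partsGF q (podMultiplicities k) (M ℕ.* 2)
        Ped = partsGF q pedMultiplicities (M ℕ.* 2)
        E = Π< M (λ i → 1# - x ^ suc i)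
        O = Π< M (λ i → 1# - o i)
        O⁺ = Π< M (λ i → 1# + o i)
        -- The inverses of 1 - x^(2n+2) are finite geometric sums, as x^(2n+2) is a multiple of `q`.
        open Shanks x (λ n → multiplicityGF anyMultiplicity (x * x * X n))
          (λ n → anyMultiplicityGF (q * x * X n)
            (solve 2 (λ q Y → (q :* q) :* (q :* q) :* Y := q :* (q :* (q :* q) :* Y)) refl q (X n)))
          using (gauss)

open import Defs
open import Data.Nat using (ℕ; _*_; _<_)
open import Relation.Binary.PropositionalEquality using (_≡_)
open PowerSeries
open GeneratingFunctions
open import Data.Integer.Base as ℤ using (0ℤ; 1ℤ)
import Data.Integer.Properties as ℤ
open import Data.List.Base using (List; []; _∷_; _++_; map; concatMap; length; replicate; filter)
open import Data.List.Properties using (length-++; length-map; length-filter; filter-accept; filter-reject; filter-++; ++-cancelˡ)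
open import Data.List.Membership.Propositional using (_∈_; _∉_; find; lose)
open import Data.List.Membership.Propositional.Properties
open import Data.List.Membership.Propositional.Properties.WithK using (unique∧set⇒bag)
open import Data.List.Membership.DecPropositional Data.Nat._≟_ using (_∈?_)
open import Data.List.Relation.Binary.BagAndSetEquality using (∼bag⇒↭)
open import Data.List.Relation.Binary.Disjoint.Propositional using (Disjoint)
open import Data.List.Relation.Binary.Permutation.Propositional.Properties using (↭-length)
open import Data.List.Relation.Unary.All as All using (All; []; _∷_)
import Data.List.Relation.Unary.All.Properties as All
open import Data.List.Relation.Unary.AllPairs as AllPairs using ([]; _∷_)
import Data.List.Relation.Unary.AllPairs.Properties as AllPairs
open import Data.List.Relation.Unary.Any using (here; there)
open import Data.List.Relation.Unary.Linked as Linked using (Linked; []; [-]; _∷_)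
open import Data.List.Relation.Unary.Linked.Properties using (Linked⇒All)
open import Data.List.Relation.Unary.Unique.Propositional using (Unique)
import Data.List.Relation.Unary.Unique.Propositional.Properties as Unique
open import Data.Nat using (zero; suc; _+_; _≤_; _≥_; z≤n; s≤s; _≟_; _≤?_; _<?_; _⊓_)
open import Data.Nat.Divisibility using (_∣?_; divides; n∣m*n)
open import Data.Nat.ListAction using (sum)
open import Data.Nat.ListAction.Properties using (sum-++)
open import Data.Nat.Properties hiding (_≟_; _≤?_; _<?_)
open import Data.Nat.Solver using (module +-*-Solver)
open import Data.Product using (_×_; _,_; proj₁; proj₂; ∃; ∃₂)
open import Data.Sum using (inj₁; inj₂)
open import Function.Base using (_∘_)
open import Function.Bundles using (_⇔_; mk⇔; Equivalence)
open import Relation.Binary.PropositionalEquality using (_≢_; refl; sym; trans; cong; cong₂; subst; module ≡-Reasoning)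
open import Relation.Nullary using (yes; no; contradiction)
open import Relation.Unary using (Decidable)

-- Enumeration of partitions with prescribed multiplicities.

-- The counterpart for families of lists of multiplication by q^k: the lengths are shifted by `k`.
delay : ∀ {A : Set} → ℕ → (ℕ → List A) → ℕ → List A
delay zero    f n       = f n
delay (suc k) f zero    = []
delay (suc k) f (suc n) = delay k f n

∈-delay⁺ : ∀ {A : Set} {a : A} k f {r} → a ∈ f r → a ∈ delay k f (k + r)
∈-delay⁺ zero    f a∈ = a∈
∈-delay⁺ (suc k) f a∈ = ∈-delay⁺ k f a∈

∈-delay⁻ : ∀ {A : Set} {a : A} k f n → a ∈ delay k f n → ∃ λ r → k + r ≡ n × a ∈ f r
∈-delay⁻ zero    f n       a∈ = n , refl , a∈
∈-delay⁻ (suc k) f (suc n) a∈ with r , eq , a∈′ ← ∈-delay⁻ k f n a∈ = r , cong suc eq , a∈′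

delay-unique : ∀ {A : Set} k (f : ℕ → List A) n → (∀ r → Unique (f r)) → Unique (delay k f n)
delay-unique zero    f n       u = u n
delay-unique (suc k) f zero    u = []
delay-unique (suc k) f (suc n) u = delay-unique k f n u

multiplicity-replicate-≡ : ∀ p j ρ → multiplicity p (replicate j p ++ ρ) ≡ j + multiplicity p ρ
multiplicity-replicate-≡ p zero    ρ = refl
multiplicity-replicate-≡ p (suc j) ρ =
  trans (cong length (filter-accept (p ≟_) refl)) (cong suc (multiplicity-replicate-≡ p j ρ))

multiplicity-replicate-≢ : ∀ {i p} → i ≢ p → ∀ j ρ → multiplicity i (replicate j p ++ ρ) ≡ multiplicity i ρ
multiplicity-replicate-≢         i≢p zero    ρ = refl
multiplicity-replicate-≢ {i} {p} i≢p (suc j) ρ =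
  trans (cong length (filter-reject (i ≟_) i≢p)) (multiplicity-replicate-≢ i≢p j ρ)

multiplicity-∉ : ∀ {i} π → i ∉ π → multiplicity i π ≡ 0
multiplicity-∉     []      i∉ = refl
multiplicity-∉ {i} (x ∷ π) i∉ =
  trans (cong length (filter-reject (i ≟_) (i∉ ∘ here))) (multiplicity-∉ π (i∉ ∘ there))

∈⇒0<multiplicity : ∀ {i π} → i ∈ π → 0 < multiplicity i π
∈⇒0<multiplicity {i} i∈ = ∈-length (∈-filter⁺ (i ≟_) i∈ refl)

0<multiplicity⇒∈ : ∀ {i} π → 0 < multiplicity i π → i ∈ π
0<multiplicity⇒∈ {i} π 0<m with i ∈? π
... | yes i∈ = i∈
... | no  i∉ = contradiction (multiplicity-∉ π i∉) (>⇒≢ 0<m)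

length≤sum : ∀ {π} → All (0 <_) π → length π ≤ sum π
length≤sum []          = z≤n
length≤sum (0<x ∷ pos) = +-mono-≤ 0<x (length≤sum pos)

multiplicity≤ : ∀ {n π} i → IsPartition n π → multiplicity i π ≤ n
multiplicity≤ {π = π} i (_ , pos , refl) = ≤-trans (length-filter (i ≟_) π) (length≤sum pos)

prepend-linked : ∀ {p} j {ρ} → All (_≤ p) ρ → Linked _≥_ ρ → Linked _≥_ (replicate j p ++ ρ)
prepend-linked zero          ρ≤ l = l
prepend-linked (suc zero)    []        l = [-]
prepend-linked (suc zero)    (y≤p ∷ _) l = y≤p ∷ l
prepend-linked (suc (suc j)) ρ≤ l = ≤-refl ∷ prepend-linked (suc j) ρ≤ l

sum-replicate : ∀ j p → sum (replicate j p) ≡ p * j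
sum-replicate zero    p = sym (*-zeroʳ p)
sum-replicate (suc j) p = trans (cong (p +_) (sum-replicate j p)) (sym (*-suc p j))

sum-prepend : ∀ j p ρ → sum (replicate j p ++ ρ) ≡ p * j + sum ρ
sum-prepend j p ρ = trans (sum-++ (replicate j p) ρ) (cong (_+ sum ρ) (sum-replicate j p))

-- In a weakly decreasing list the copies of the upper bound stand in front; once the head is
-- smaller, so is everything after it.
split-largest : ∀ m {π} → Linked _≥_ π → All (_≤ suc m) π →
                ∃₂ λ j ρ → π ≡ replicate j (suc m) ++ ρ × Linked _≥_ ρ × All (_≤ m) ρ
split-largest m {[]}    l _ = 0 , [] , refl , [] , []
split-largest m {x ∷ π} l (x≤ ∷ π≤) with m≤n⇒m<n∨m≡n x≤
... | inj₁ (s≤s x≤m) = 0 , x ∷ π , refl , l ,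
  All.map (λ y≤x → ≤-trans y≤x x≤m) (Linked⇒All (λ a≥b b≥c → ≤-trans b≥c a≥b) ≤-refl l)
... | inj₂ refl with j , ρ , refl , lρ , ρ≤ ← split-largest m (Linked.tail l) π≤ =
  suc j , ρ , refl , lρ , ρ≤

-- J i lists the multiplicities allowed for the part i.
record Restricted (J : ℕ → List ℕ) (m n : ℕ) (π : List ℕ) : Set where
  constructor restricted
  field
    isPartition    : IsPartition n π
    bounded        : All (_≤ m) π
    multiplicities : ∀ {i} → 0 < i → i ≤ m → multiplicity i π ∈ J i

-- The recursion on the largest admissible part follows that of `partsGF`, one `block` for each
-- summand of `multiplicityGF`, so that lengths become coefficients.
enumerate : (ℕ → List ℕ) → ℕ → ℕ → List (List ℕ)

block : (ℕ → List ℕ) → ℕ → ℕ → ℕ → List (List ℕ)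
block J m n j = delay (suc m * j) (λ r → map (replicate j (suc m) ++_) (enumerate J m r)) n

enumerate J zero    zero    = [] ∷ []
enumerate J zero    (suc n) = []
enumerate J (suc m) n       = concatMap (block J m n) (J (suc m))

∈-block⁻ : ∀ J m n j {π} → π ∈ block J m n j →
           ∃₂ λ r ρ → suc m * j + r ≡ n × ρ ∈ enumerate J m r × π ≡ replicate j (suc m) ++ ρ
∈-block⁻ J m n j π∈ with r , eq , π∈′ ← ∈-delay⁻ (suc m * j) _ n π∈
  with ρ , ρ∈ , refl ← ∈-map⁻ (replicate j (suc m) ++_) π∈′ = r , ρ , eq , ρ∈ , refl

bounded⇒∉ : ∀ {m ρ} → All (_≤ m) ρ → suc m ∉ ρ
bounded⇒∉ ρ≤ p∈ = <⇒≱ ≤-refl (All.lookup ρ≤ p∈)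

multiplicity-largest : ∀ m j {ρ} → All (_≤ m) ρ → multiplicity (suc m) (replicate j (suc m) ++ ρ) ≡ j
multiplicity-largest m j {ρ} ρ≤ = trans (multiplicity-replicate-≡ (suc m) j ρ)
  (trans (cong (j +_) (multiplicity-∉ ρ (bounded⇒∉ ρ≤))) (+-identityʳ j))

enumerate-sound : ∀ J m n {π} → π ∈ enumerate J m n → Restricted J m n π
enumerate-sound J zero zero (here refl) = restricted ([] , [] , refl) [] (λ { (s≤s _) () })
enumerate-sound J (suc m) n π∈ with find (∈-concatMap⁻ (block J m n) {xs = J (suc m)} π∈)
... | j , j∈ , π∈block with ∈-block⁻ J m n j π∈block
... | r , ρ , refl , ρ∈ , refl with enumerate-sound J m r ρ∈
... | restricted (l , pos , refl) ρ≤ mult = restricted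
  ( prepend-linked j (All.map m≤n⇒m≤1+n ρ≤) l
  , All.++⁺ (All.replicate⁺ j (s≤s z≤n)) pos
  , sum-prepend j (suc m) ρ )
  (All.++⁺ (All.replicate⁺ j ≤-refl) (All.map m≤n⇒m≤1+n ρ≤))
  mult′
  where
  mult′ : ∀ {i} → 0 < i → i ≤ suc m → multiplicity i (replicate j (suc m) ++ ρ) ∈ J i
  mult′ {i} 0<i i≤ with m≤n⇒m<n∨m≡n i≤
  ... | inj₁ (s≤s i≤m) = subst (_∈ J i) (sym (multiplicity-replicate-≢ (<⇒≢ (s≤s i≤m)) j ρ)) (mult 0<i i≤m)
  ... | inj₂ refl      = subst (_∈ J i) (sym (multiplicity-largest m j ρ≤)) j∈

enumerate-complete : ∀ J m n {π} → Restricted J m n π → π ∈ enumerate J m n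
enumerate-complete J zero n {[]}    (restricted (_ , _ , refl) _ _) = here refl
enumerate-complete J zero n {x ∷ π} (restricted (_ , 0<x ∷ _ , _) (x≤0 ∷ _) _) = contradiction x≤0 (<⇒≱ 0<x)
enumerate-complete J (suc m) n (restricted (l , pos , refl) π≤ mult) with split-largest m l π≤
... | j , ρ , refl , lρ , ρ≤ = ∈-concatMap⁺ (block J m _) (lose j∈
  (subst (λ n → replicate j (suc m) ++ ρ ∈ block J m n j) (sym (sum-prepend j (suc m) ρ))
    (∈-delay⁺ (suc m * j) _ (∈-map⁺ (replicate j (suc m) ++_) (enumerate-complete J m (sum ρ)
      (restricted (lρ , All.++⁻ʳ (replicate j (suc m)) pos , refl) ρ≤ mult′))))))
  where
  j∈ : j ∈ J (suc m)
  j∈ = subst (_∈ J (suc m)) (multiplicity-largest m j ρ≤) (mult (s≤s z≤n) ≤-refl)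

  mult′ : ∀ {i} → 0 < i → i ≤ m → multiplicity i ρ ∈ J i
  mult′ {i} 0<i i≤m = subst (_∈ J i) (multiplicity-replicate-≢ (<⇒≢ (s≤s i≤m)) j ρ) (mult 0<i (m≤n⇒m≤1+n i≤m))

-- Within a block the common prefix can be cancelled; different blocks are disjoint because the
-- multiplicity of `suc m` recovers `j`.
enumerate-unique : ∀ J → (∀ p → Unique (J p)) → ∀ m n → Unique (enumerate J m n)
enumerate-unique J J! zero    zero    = [] ∷ []
enumerate-unique J J! zero    (suc n) = []
enumerate-unique J J! (suc m) n = Unique.concat⁺
  (All.map⁺ (All.universal (λ j → delay-unique (suc m * j) _ n
    (λ r → Unique.map⁺ (++-cancelˡ (replicate j (suc m)) _ _) (enumerate-unique J J! m r))) _))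
  (AllPairs.map⁺ (AllPairs.map disjoint (J! (suc m))))
  where
  block-multiplicity : ∀ j {π} → π ∈ block J m n j → multiplicity (suc m) π ≡ j
  block-multiplicity j π∈ with r , ρ , _ , ρ∈ , refl ← ∈-block⁻ J m n j π∈ =
    multiplicity-largest m j (Restricted.bounded (enumerate-sound J m r ρ∈))

  disjoint : ∀ {j j′} → j ≢ j′ → Disjoint (block J m n j) (block J m n j′)
  disjoint j≢j′ (π∈ , π∈′) = j≢j′ (trans (sym (block-multiplicity _ π∈)) (block-multiplicity _ π∈′))

length-by-membership : ∀ {A : Set} {xs ys : List A} → Unique xs → Unique ys →
                       (∀ {a} → a ∈ xs ⇔ a ∈ ys) → length xs ≡ length ys
length-by-membership xs! ys! xs⇔ys = ↭-length (∼bag⇒↭ (unique∧set⇒bag xs! ys! xs⇔ys))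

-- The sum of meex values as a sum of counts over thresholds.

Σℕ : ℕ → (ℕ → ℕ) → ℕ
Σℕ zero    f = 0
Σℕ (suc n) f = Σℕ n f + f n

Σℕ-cong : ∀ n {f g} → (∀ {i} → i < n → f i ≡ g i) → Σℕ n f ≡ Σℕ n g
Σℕ-cong zero    f≡g = refl
Σℕ-cong (suc n) f≡g = cong₂ _+_ (Σℕ-cong n (λ i<n → f≡g (m≤n⇒m≤1+n i<n))) (f≡g ≤-refl)

Σℕ-zero : ∀ n → Σℕ n (λ _ → 0) ≡ 0
Σℕ-zero zero    = refl
Σℕ-zero (suc n) = trans (+-identityʳ _) (Σℕ-zero n)

Σℕ-+ : ∀ n f g → Σℕ n (λ i → f i + g i) ≡ Σℕ n f + Σℕ n g
Σℕ-+ zero    f g = refl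
Σℕ-+ (suc n) f g = trans (cong (_+ (f n + g n)) (Σℕ-+ n f g))
  (+-*-Solver.solve 4 (λ a b c d → (a :+ b) :+ (c :+ d) := (a :+ c) :+ (b :+ d)) refl
    (Σℕ n f) (Σℕ n g) (f n) (g n))
  where open +-*-Solver using (_:+_; _:=_)

_<meex?_ : ∀ k → Decidable (λ π → k * 2 < meex π)
k <meex? π = k * 2 <? meex π

-- Exactly the thresholds k < t lie below the meex. Filtering a one-element list serves as the
-- indicator function, the form in which it arises when a list is split at its head.
Σ-below-meex : ∀ M t π → meex π ≡ t * 2 → Σℕ M (λ k → length (filter (k <meex?_) (π ∷ []))) ≡ M ⊓ t
Σ-below-meex zero    t π eq = refl
Σ-below-meex (suc M) t π eq rewrite Σ-below-meex M t π eq with suc M ≤? t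
... | yes M<t rewrite m≤n⇒m⊓n≡m M<t | m≤n⇒m⊓n≡m (<⇒≤ M<t)
                    | filter-accept (M <meex?_) {x = π} {xs = []}
                        (subst (M * 2 <_) (sym eq) (*-monoˡ-< 2 M<t)) = +-comm M 1
... | no M≮t rewrite m≥n⇒m⊓n≡n (≮⇒≥ M≮t) | m≥n⇒m⊓n≡n (m≤n⇒m≤1+n (≮⇒≥ M≮t))
                   | filter-reject (M <meex?_) {x = π} {xs = []}
                       (λ M<meex → M≮t (*-cancelʳ-< 2 M t (subst (M * 2 <_) eq M<meex))) = +-identityʳ t

-- Otherwise minimality of the meex would make 2M a part, although it exceeds the sum of all parts.
meex≤ : ∀ M π → sum π < M * 2 → meex π ≤ M * 2
meex≤ M π sum< = ≮⇒≥ λ M<meex → <⇒≱ sum<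
  (∈⇒≤sum (IsMeex.least (meex-isMeex π) (M * 2) (≤-<-trans z≤n sum<) (n∣m*n M) M<meex))

-- A meex 2t is twice the number of k with 2k < 2t, and the two summations are exchanged. The bound
-- on the sums gives t ≤ M, so no threshold is lost.
sum-meex : ∀ M L → All (λ π → sum π < M * 2) L →
           sum (map meex L) ≡ 2 * Σℕ M (λ k → length (filter (k <meex?_) L))
sum-meex M []      []          = sym (cong (2 *_) (Σℕ-zero M))
sum-meex M (π ∷ L) (sum< ∷ L<) with IsMeex.even (meex-isMeex π)
... | divides t eq = begin
  meex π + sum (map meex L)
    ≡⟨ cong₂ _+_ (trans eq (*-comm t 2)) (sum-meex M L L<) ⟩
  2 * t + 2 * Σℕ M (count L)
    ≡⟨ *-distribˡ-+ 2 t _ ⟨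
  2 * (t + Σℕ M (count L))
    ≡⟨ cong (λ s → 2 * (s + Σℕ M (count L))) (trans (Σ-below-meex M t π eq) (m≥n⇒m⊓n≡n t≤M)) ⟨
  2 * (Σℕ M (count (π ∷ [])) + Σℕ M (count L))
    ≡⟨ cong (2 *_) (Σℕ-+ M (count (π ∷ [])) (count L)) ⟨
  2 * Σℕ M (λ k → count (π ∷ []) k + count L k)
    ≡⟨ cong (2 *_) (Σℕ-cong M λ {k} _ → trans (cong length (filter-++ (k <meex?_) (π ∷ []) L))
         (length-++ (filter (k <meex?_) (π ∷ [])))) ⟨
  2 * Σℕ M (count (π ∷ L)) ∎
  where
  open ≡-Reasoning
  count : List (List ℕ) → ℕ → ℕ
  count L k = length (filter (k <meex?_) L)
  t≤M : t ≤ M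
  t≤M = *-cancelʳ-≤ t M 2 (subst (_≤ M * 2) eq (meex≤ M π sum<))

<meex⇔ : ∀ k π → k * 2 < meex π ⇔ (∀ i → 0 < i → Even i → i ≤ k * 2 → i ∈ π)
<meex⇔ k π = mk⇔
  (λ k<meex i 0<i even i≤k → least i 0<i even (≤-<-trans i≤k k<meex))
  (λ all∈ → ≰⇒> λ meex≤k → missing (all∈ (meex π) positive even meex≤k))
  where open IsMeex (meex-isMeex π)

∈-atMostOnce : ∀ {c} → c ∈ 1 ∷ 0 ∷ [] ⇔ c ≤ 1
∈-atMostOnce = mk⇔ (λ { (here refl) → ≤-refl ; (there (here refl)) → z≤n })
  (λ { z≤n → there (here refl) ; (s≤s z≤n) → here refl })

-- The hypothesis speaks only of numbers that occur in `π`; any other number has multiplicity 0.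
repeated-bound : ∀ {P : ℕ → Set} {π} → All (λ k → P k → multiplicity k π ≤ 1) π →
                 ∀ k → P k → multiplicity k π ≤ 1
repeated-bound {π = π} once k Pk with k ∈? π
... | yes k∈ = All.lookup once k∈ Pk
... | no  k∉ = ≤-trans (≤-reflexive (multiplicity-∉ π k∉)) z≤n

-- Coefficients of the generating functions as numbers of partitions.

module Counting (n : ℕ) where

  open GF n using (_≋_; at; Σ<; multiplicityGF; partsGF; _^_; pointwise;
    anyMultiplicity; atLeastOnce; podMultiplicities; pedMultiplicities; module Nilpotent)
  module R = GF n

  q : Series
  q zero    = 0ℤ
  q (suc i) = const 1ℤ i

  q-⊛ : ∀ i f → (q ⊛ f) (suc i) ≡ f i
  q-⊛ i f = trans (ℤ.+-identityˡ _) (R.⊛-identityˡ i f)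

  q^-below : ∀ k i → i < k → (q ^ k) i ≡ 0ℤ
  q^-below (suc k) zero    _         = refl
  q^-below (suc k) (suc i) (s≤s i<k) = trans (q-⊛ i (q ^ k)) (q^-below k i i<k)

  q-nilpotent : (q ^ suc n) ≋ const 0ℤ
  q-nilpotent = R.agree λ {i} i≤n → trans (q^-below (suc n) i (s≤s i≤n)) (sym (zeros i))
    where
    zeros : ∀ i → const 0ℤ i ≡ 0ℤ
    zeros zero    = refl
    zeros (suc i) = refl

  lengths : ∀ {A : Set} → (ℕ → List A) → Series
  lengths L i = ℤ.+ length (L i)

  lengths-delay : ∀ {A : Set} k (L : ℕ → List A) i → lengths (delay k L) i ≡ (q ^ k ⊛ lengths L) i
  lengths-delay zero    L i       = sym (R.⊛-identityˡ i _)
  lengths-delay (suc k) L zero    = sym (⊛-assoc zero q (q ^ k) (lengths L))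
  lengths-delay (suc k) L (suc i) = trans (lengths-delay k L i)
    (sym (trans (⊛-assoc (suc i) q (q ^ k) (lengths L)) (q-⊛ i _)))

  lengths-map : ∀ J m j → lengths (λ r → map (replicate j (suc m) ++_) (enumerate J m r)) ≋ lengths (enumerate J m)
  lengths-map J m j = pointwise λ r → cong ℤ.+_ (length-map _ (enumerate J m r))

  -- The block with `j` copies of the part m+1 is shifted by (m+1)j, hence contributes the j-th
  -- power of q^(m+1) times the series for the smaller parts.
  lengths-concatMap : ∀ J m K → lengths (λ i → concatMap (block J m i) K)
                               ≋ (multiplicityGF K (q ^ suc m) ⊛ lengths (enumerate J m))
  lengths-concatMap J m []      = pointwise λ i → sym (trans (const-⊛ i 0ℤ _) (ℤ.*-zeroˡ (lengths (enumerate J m) i)))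
  lengths-concatMap J m (j ∷ K) = R.trans
    (pointwise λ i → trans (cong ℤ.+_ (length-++ (block J m i j)))
      (trans (ℤ.pos-+ (length (block J m i j)) _) (sym (⊕-at _ (lengths (λ i → concatMap (block J m i) K)) i))))
    (R.trans (R.+-cong block-lengths (lengths-concatMap J m K)) (R.sym (R.distribʳ _ ((q ^ suc m) ^ j) _)))
    where
    block-lengths : lengths (λ i → block J m i j) ≋ (((q ^ suc m) ^ j) ⊛ lengths (enumerate J m))
    block-lengths = R.trans (pointwise λ i → lengths-delay (suc m * j) _ i)
      (R.*-cong (R.sym (R.^-assocʳ q (suc m) j)) (lengths-map J m j))

  lengths-enumerate : ∀ J m → lengths (enumerate J m) ≋ partsGF q J m
  lengths-enumerate J zero    = pointwise λ { zero → refl ; (suc i) → refl }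
  lengths-enumerate J (suc m) = R.trans (lengths-concatMap J m (J (suc m))) (R.*-congˡ (lengths-enumerate J m))

  Σ<-lengths : ∀ {A : Set} M (L : ℕ → ℕ → List A) i → Σ< M (λ k → lengths (L k)) i ≡ ℤ.+ Σℕ M (λ k → length (L k i))
  Σ<-lengths zero    L zero    = refl
  Σ<-lengths zero    L (suc i) = refl
  Σ<-lengths (suc M) L i = trans (⊕-at _ (lengths (L M)) i)
    (trans (cong (ℤ._+ lengths (L M) i) (Σ<-lengths M L i)) (sym (ℤ.pos-+ (Σℕ M (λ k → length (L k i))) _)))

  -- Any bound from `n` on admits all parts of a partition of `n`. This one fits the product
  -- formulas, which pair odd and even parts, and covers every even part demanded by a threshold k ≤
  -- n+1.
  maxPart : ℕ
  maxPart = suc n * 2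

  -- The coefficient of q^n in `pod-ped-identity`, the last one that equality modulo q^(n+1)
  -- controls.
  Σ-enumerate : Σℕ (suc n) (λ k → length (enumerate (podMultiplicities k) maxPart n))
                ≡ length (enumerate pedMultiplicities maxPart n)
  Σ-enumerate = ℤ.+-injective (trans
    (sym (Σ<-lengths (suc n) (λ k → enumerate (podMultiplicities k) maxPart) n))
    (at (R.trans (R.Σ<-cong (suc n) (λ {k} _ → lengths-enumerate (podMultiplicities k) maxPart))
      (R.trans (Nilpotent.pod-ped-identity q q-nilpotent) (R.sym (lengths-enumerate pedMultiplicities maxPart))))
      ≤-refl))

  ∈-anyMultiplicity : ∀ {c} → c ≤ n → c ∈ anyMultiplicity
  ∈-anyMultiplicity c≤n = ∈-downFrom⁺ (s≤s c≤n)

  ∈-atLeastOnce⁺ : ∀ {c} → 0 < c → c ≤ n → c ∈ atLeastOnce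
  ∈-atLeastOnce⁺ (s≤s _) c≤n = ∈-map⁺ suc (∈-downFrom⁺ (m≤n⇒m≤1+n c≤n))

  ∈-atLeastOnce⁻ : ∀ {c} → c ∈ atLeastOnce → 0 < c
  ∈-atLeastOnce⁻ c∈ with _ , _ , refl ← ∈-map⁻ suc c∈ = s≤s z≤n

  ∈-podMultiplicities⁺ : ∀ k p {c} → c ≤ n → (Odd p → c ≤ 1) → (Even p → p ≤ k * 2 → 0 < c) →
                         c ∈ podMultiplicities k p
  ∈-podMultiplicities⁺ k p c≤n odd even with 2 ∣? p | p ≤? k * 2
  ... | no 2∤p  | _      = Equivalence.from ∈-atMostOnce (odd 2∤p)
  ... | yes 2∣p | yes p≤ = ∈-atLeastOnce⁺ (even 2∣p p≤) c≤n
  ... | yes 2∣p | no _   = ∈-anyMultiplicity c≤n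

  ∈-podMultiplicities⁻ : ∀ k p {c} → c ∈ podMultiplicities k p → (Odd p → c ≤ 1) × (Even p → p ≤ k * 2 → 0 < c)
  ∈-podMultiplicities⁻ k p c∈ with 2 ∣? p | p ≤? k * 2
  ... | no 2∤p  | _     = (λ _ → Equivalence.to ∈-atMostOnce c∈) , (λ 2∣p → contradiction 2∣p 2∤p)
  ... | yes 2∣p | yes _ = contradiction 2∣p , (λ _ _ → ∈-atLeastOnce⁻ c∈)
  ... | yes 2∣p | no p≰ = contradiction 2∣p , (λ _ p≤ → contradiction p≤ p≰)

  podMultiplicities-unique : ∀ k p → Unique (podMultiplicities k p)
  podMultiplicities-unique k p with 2 ∣? p | p ≤? k * 2
  ... | no _  | _     = ((λ ()) ∷ []) ∷ [] ∷ []
  ... | yes _ | yes _ = Unique.map⁺ suc-injective (Unique.downFrom⁺ (suc n))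
  ... | yes _ | no _  = Unique.downFrom⁺ (suc n)

  ∈-pedMultiplicities⁺ : ∀ p {c} → c ≤ n → (Even p → c ≤ 1) → c ∈ pedMultiplicities p
  ∈-pedMultiplicities⁺ p c≤n even with 2 ∣? p
  ... | no _    = ∈-anyMultiplicity c≤n
  ... | yes 2∣p = Equivalence.from ∈-atMostOnce (even 2∣p)

  ∈-pedMultiplicities⁻ : ∀ p {c} → c ∈ pedMultiplicities p → Even p → c ≤ 1
  ∈-pedMultiplicities⁻ p c∈ even with 2 ∣? p
  ... | no 2∤p = contradiction even 2∤p
  ... | yes _  = Equivalence.to ∈-atMostOnce c∈

  pedMultiplicities-unique : ∀ p → Unique (pedMultiplicities p)
  pedMultiplicities-unique p with 2 ∣? p
  ... | no _  = Unique.downFrom⁺ (suc n)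
  ... | yes _ = ((λ ()) ∷ []) ∷ [] ∷ []

  n≤maxPart : n ≤ maxPart
  n≤maxPart = ≤-trans (n≤1+n n) (m≤m*n (suc n) 2)

  part≤maxPart : ∀ {π i} → IsPartition n π → i ∈ π → i ≤ maxPart
  part≤maxPart (_ , _ , refl) i∈ = ≤-trans (∈⇒≤sum i∈) n≤maxPart

  part-positive : ∀ {π i} → IsPartition n π → i ∈ π → 0 < i
  part-positive (_ , pos , _) = All.lookup pos

  length-Ped : length (Ped n) ≡ length (enumerate pedMultiplicities maxPart n)
  length-Ped = length-by-membership
    (Unique.filter⁺ noEvenPartRepeated? (partitions-unique n))
    (enumerate-unique _ pedMultiplicities-unique maxPart n)
    (mk⇔ to from)
    where
    to : ∀ {π} → π ∈ Ped n → π ∈ enumerate pedMultiplicities maxPart n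
    to {π} π∈ with π∈partitions , once ← ∈-filter⁻ noEvenPartRepeated? {xs = partitions n} π∈ =
      enumerate-complete _ maxPart n (restricted part (All.tabulate (part≤maxPart part))
        (λ {i} _ _ → ∈-pedMultiplicities⁺ i (multiplicity≤ i part) (repeated-bound once i)))
      where part = Equivalence.to (∈-partitions n π) π∈partitions

    from : ∀ {π} → π ∈ enumerate pedMultiplicities maxPart n → π ∈ Ped n
    from {π} π∈ with restricted part _ mult ← enumerate-sound _ maxPart n π∈ =
      ∈-filter⁺ noEvenPartRepeated? (Equivalence.from (∈-partitions n π) part)
        (All.tabulate λ {i} i∈ → ∈-pedMultiplicities⁻ i (mult (part-positive part i∈) (part≤maxPart part i∈)))

  -- By `<meex⇔` the threshold condition demands positive multiplicity of each even number from 2 to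
  -- 2k, so it can be read off from the multiplicities. The bound on `k` keeps these numbers within
  -- `maxPart`.
  length-Pod : ∀ {k} → k ≤ suc n →
               length (filter (k <meex?_) (Pod n)) ≡ length (enumerate (podMultiplicities k) maxPart n)
  length-Pod {k} k≤ = length-by-membership
    (Unique.filter⁺ (k <meex?_) (Unique.filter⁺ noOddPartRepeated? (partitions-unique n)))
    (enumerate-unique _ (podMultiplicities-unique k) maxPart n)
    (mk⇔ to from)
    where
    to : ∀ {π} → π ∈ filter (k <meex?_) (Pod n) → π ∈ enumerate (podMultiplicities k) maxPart n
    to {π} π∈ with π∈Pod , k<meex ← ∈-filter⁻ (k <meex?_) {xs = Pod n} π∈
      with π∈partitions , once ← ∈-filter⁻ noOddPartRepeated? {xs = partitions n} π∈Pod =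
      enumerate-complete _ maxPart n (restricted part (All.tabulate (part≤maxPart part))
        (λ {i} 0<i _ → ∈-podMultiplicities⁺ k i (multiplicity≤ i part) (repeated-bound once i)
          (λ even i≤ → ∈⇒0<multiplicity (Equivalence.to (<meex⇔ k π) k<meex i 0<i even i≤))))
      where part = Equivalence.to (∈-partitions n π) π∈partitions

    from : ∀ {π} → π ∈ enumerate (podMultiplicities k) maxPart n → π ∈ filter (k <meex?_) (Pod n)
    from {π} π∈ with restricted part _ mult ← enumerate-sound _ maxPart n π∈ =
      ∈-filter⁺ (k <meex?_)
        (∈-filter⁺ noOddPartRepeated? (Equivalence.from (∈-partitions n π) part)
          (All.tabulate λ {i} i∈ →
            proj₁ (∈-podMultiplicities⁻ k i (mult (part-positive part i∈) (part≤maxPart part i∈)))))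
        (Equivalence.from (<meex⇔ k π) λ i 0<i even i≤ → 0<multiplicity⇒∈ π
          (proj₂ (∈-podMultiplicities⁻ k i (mult 0<i (≤-trans i≤ (*-monoˡ-≤ 2 k≤)))) even i≤))

  Pod-sums : All (λ π → sum π < suc n * 2) (Pod n)
  Pod-sums = All.tabulate λ {π} π∈ → sum< (Equivalence.to (∈-partitions n π)
    (proj₁ (∈-filter⁻ noOddPartRepeated? {xs = partitions n} π∈)))
    where
    sum< : ∀ {π} → IsPartition n π → sum π < suc n * 2
    sum< (_ , _ , refl) = m≤m*n (suc n) 2

theorem1p5 : (n : ℕ) → 0 < n → σ-od-meex n ≡ 2 * p-ed n
theorem1p5 n _ = begin
  σ-od-meex n
    ≡⟨ sum-meex (suc n) (Pod n) Pod-sums ⟩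
  2 * Σℕ (suc n) (λ k → length (filter (k <meex?_) (Pod n)))
    ≡⟨ cong (2 *_) (Σℕ-cong (suc n) (λ k<M → length-Pod (<⇒≤ k<M))) ⟩
  2 * Σℕ (suc n) (λ k → length (enumerate (podMultiplicities k) maxPart n))
    ≡⟨ cong (2 *_) Σ-enumerate ⟩
  2 * length (enumerate pedMultiplicities maxPart n)
    ≡⟨ cong (2 *_) length-Ped ⟨
  2 * p-ed n ∎
  where
  open ≡-Reasoning
  open Counting n
  open GF n using (podMultiplicities; pedMultiplicities)
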